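{- Every tree $T$ with at least two vertices has $sn(T)=1$.
   Context: Graphs are finite, undirected and simple. Let $G=(V,E)$ be a connected graph with chromatic number $\chi(G)=k\ge 2$. For $S\subset V$, a partial coloring on $G[S]$ is a proper coloring $\mathscr C_0$ of the induced subgraph $G[S]$ with colors from $\{1,\dots,k\}$ (not all colors need be used). It is a Sudoku coloring of $G$ if there is exactly one proper $k$-coloring $V\to\{1,\dots,k\}$ of $G$ whose restriction to $S$ is $\mathscr C_0$. The Sudoku number $sn(G)$ is the smallest $|S|$ such that $G[S]$ admits a Sudoku coloring of $G$. -}

module Defs where

open import Data.Fin.Base using (Fin)
open import Data.Fin.Subset using (Subset; _∈_; ∣_∣)
open import Data.List.Base using (List; _∷_; _∷ʳ_; length)
open import Data.List.Relation.Unary.Linked using (Linked)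
open import Data.List.Relation.Unary.Unique.Propositional using (Unique)
open import Data.Nat.Base using (ℕ; _≤_)
open import Data.Product using (∃; ∃!; ∃-syntax; _×_; proj₁)
open import Function.Base using (_∘_; _on_)
open import Level using (0ℓ)
open import Relation.Binary.Construct.Closure.ReflexiveTransitive using (Star)
open import Relation.Binary.Core using (Rel)
open import Relation.Binary.Definitions using (Decidable; Symmetric)
open import Relation.Binary.PropositionalEquality using (_≡_; _≢_; _≗_)
open import Relation.Nullary using (¬_)

-- Simple graphs on the vertex set V.  Decidability of adjacency is part of
-- the structure; classically it is no restriction.
record Graph (V : Set) : Set₁ where
  field
    Adj    : Rel V 0ℓ
    adj?   : Decidable Adj
    sym    : Symmetric Adj
    irrefl : ∀ {v} → ¬ Adj v v

open Graph public using (Adj)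

Connected : ∀ {V} → Graph V → Set
Connected G = ∀ u v → Star (Adj G) u v

-- The vertices u ∷ vs are distinct, there are at least three of them, and
-- consecutive ones are adjacent, with u following the last vertex of vs.
record Cycle {V} (G : Graph V) : Set where
  field
    u        : V
    vs       : List V
    long     : 2 ≤ length vs
    distinct : Unique (u ∷ vs)
    closed   : Linked (Adj G) (u ∷ (vs ∷ʳ u))

record IsTree {V} (G : Graph V) : Set where
  field
    connected : Connected G
    acyclic   : ¬ Cycle G

Proper : ∀ {V} → Graph V → (k : ℕ) → (V → Fin k) → Set
Proper G k c = ∀ {u v} → Adj G u v → c u ≢ c v

IsLeast : (ℕ → Set) → ℕ → Set
IsLeast P m = P m × (∀ j → P j → m ≤ j)

IsChromaticNumber : ∀ {V} → Graph V → ℕ → Set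
IsChromaticNumber G = IsLeast (λ k → ∃[ c ] Proper G k c)

induced : ∀ {n} → Graph (Fin n) → (S : Subset n) → Graph (∃ (_∈ S))
induced G S = record
  { Adj    = Adj G on proj₁
  ; adj?   = λ u v → Graph.adj? G (proj₁ u) (proj₁ v)
  ; sym    = Graph.sym G
  ; irrefl = Graph.irrefl G
  }

-- Colorings are functions, so uniqueness is up to pointwise equality.
IsSudokuColoring : ∀ {n} → Graph (Fin n) → (k : ℕ) →
                   (S : Subset n) → (∃ (_∈ S) → Fin k) → Set
IsSudokuColoring G k S c₀ =
  Proper (induced G S) k c₀ ×
  ∃! _≗_ (λ c → Proper G k c × (c ∘ proj₁) ≗ c₀)

-- The Sudoku number as a functional relation: it is defined exactly for
-- connected graphs of chromatic number k ≥ 2, and "sn(G) = s" is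
-- IsSudokuNumber G s.
record IsSudokuNumber {n} (G : Graph (Fin n)) (s : ℕ) : Set where
  field
    connected : Connected G
    k         : ℕ
    chromatic : IsChromaticNumber G k
    2≤k       : 2 ≤ k
    least     : IsLeast (λ m → ∃[ S ] ∣ S ∣ ≡ m × ∃[ c₀ ] IsSudokuColoring G k S c₀) s

{-# OPTIONS --safe #-}

-- Moving a colour along a walk and flipping it at every edge is the only way a
-- proper 2-colouring can behave, so on a connected graph such a colouring is
-- determined by its value at one vertex.  On a tree it also exists: a walk can
-- be shortened to a simple path with the same effect on colours, by cancelling
-- backtracking edges (any other return to a visited vertex would close a
-- cycle), and a closed simple path is trivial.  One clue is necessary, since
-- flipping all colours preserves properness.
module Submission where

open import Defs
open import Data.Nat.Base using (ℕ; zero; suc; _≤_; z≤n; s≤s)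
open import Data.Fin.Base using (Fin; zero; suc; opposite)
open import Data.Fin.Properties using (_≟_; opposite-involutive)
open import Data.Fin.Subset using (_∈_; ∣_∣; ⁅_⁆)
open import Data.Fin.Subset.Properties
  using (∣⁅x⁆∣≡1; x∈⁅x⁆; x∈⁅y⁆⇒x≡y; p⊆q⇒∣p∣≤∣q∣)
open import Data.List.Base using (List; []; _∷_; _∷ʳ_; _++_)
open import Data.List.Membership.Propositional using () renaming (_∈_ to _∈ˡ_)
open import Data.List.Membership.Propositional.Properties using (∈-∃++)
import Data.List.Membership.DecPropositional as DecMembership
open import Data.List.Relation.Binary.Permutation.Propositional using (↭⇒↭ₛ)
open import Data.List.Relation.Binary.Permutation.Propositional.Properties using (shift)
import Data.List.Relation.Binary.Permutation.Setoid.Properties as Permutation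
open import Data.List.Relation.Unary.All using ([])
open import Data.List.Relation.Unary.All.Properties using (¬Any⇒All¬; ++⁻ˡ)
open import Data.List.Relation.Unary.AllPairs using (AllPairs; []; _∷_)
open import Data.List.Relation.Unary.Any using (here; there)
open import Data.List.Relation.Unary.Linked using (Linked; [-]; _∷_)
open import Data.List.Relation.Unary.Unique.Propositional using (Unique)
open import Data.List.Relation.Unary.Unique.Propositional.Properties
  using (Unique[x∷xs]⇒x∉xs)
open import Data.Product using (∃; ∃-syntax; _×_; _,_; proj₁)
open import Function.Base using (_∘_)
open import Level using (0ℓ)
open import Relation.Binary.Construct.Closure.ReflexiveTransitive
  using (Star; ε; _◅_; _◅◅_)
open import Relation.Binary.Core using (Rel)
open import Relation.Binary.Definitions using (DecidableEquality)
open import Relation.Binary.PropositionalEquality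
  using (_≡_; _≢_; _≗_; refl; sym; trans; cong; subst; setoid; module ≡-Reasoning)
open import Relation.Nullary using (¬_; yes; no; contradiction)

opposite-≢ : (i : Fin 2) → i ≢ opposite i
opposite-≢ zero       ()
opposite-≢ (suc zero) ()

≢⇒≡opposite : {i j : Fin 2} → i ≢ j → i ≡ opposite j
≢⇒≡opposite {zero}     {zero}     i≢j = contradiction refl i≢j
≢⇒≡opposite {zero}     {suc zero} _   = refl
≢⇒≡opposite {suc zero} {zero}     _   = refl
≢⇒≡opposite {suc zero} {suc zero} i≢j = contradiction refl i≢j

opposite-injective : {i j : Fin 2} → opposite i ≡ opposite j → i ≡ j
opposite-injective {i} {j} eq =
  trans (sym (opposite-involutive i)) (trans (cong opposite eq) (opposite-involutive j))

module _ {A : Set} {R : Rel A 0ℓ} where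

  AllPairs-++⁻ˡ : ∀ xs {ys} → AllPairs R (xs ++ ys) → AllPairs R xs
  AllPairs-++⁻ˡ []       _          = []
  AllPairs-++⁻ˡ (x ∷ xs) (px ∷ pxs) = ++⁻ˡ xs px ∷ AllPairs-++⁻ˡ xs pxs

  Linked-∷ʳ⁻ : ∀ xs {y ys} → Linked R (xs ++ y ∷ ys) → Linked R (xs ∷ʳ y)
  Linked-∷ʳ⁻ []            _        = [-]
  Linked-∷ʳ⁻ (x ∷ [])      (r ∷ _)  = r ∷ [-]
  Linked-∷ʳ⁻ (x ∷ y ∷ xs)  (r ∷ rs) = r ∷ Linked-∷ʳ⁻ (y ∷ xs) rs

  targets : ∀ {u v} → Star R u v → List A
  targets ε                 = []
  targets (_◅_ {j = x} _ w) = x ∷ targets w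

  Simple : ∀ {u v} → Star R u v → Set
  Simple {u} w = Unique (u ∷ targets w)

  targets-linked : ∀ {u v} (w : Star R u v) → Linked R (u ∷ targets w)
  targets-linked ε       = [-]
  targets-linked (r ◅ w) = r ∷ targets-linked w

  end∈ : ∀ {u v} (w : Star R u v) → v ∈ˡ u ∷ targets w
  end∈ ε       = here refl
  end∈ (_ ◅ w) = there (end∈ w)

  -- Colours travel backwards: `i` is the colour at the end `v`, the result is the colour it forces
  -- at the start `u`. Only the parity of the length matters.
  propagate : ∀ {u v} → Star R u v → Fin 2 → Fin 2
  propagate ε       i = i
  propagate (_ ◅ w) i = opposite (propagate w i)

  propagate-◅◅ : ∀ {u v x} (w : Star R u v) (w′ : Star R v x) i →
                 propagate (w ◅◅ w′) i ≡ propagate w (propagate w′ i)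
  propagate-◅◅ ε       w′ i = refl
  propagate-◅◅ (_ ◅ w) w′ i = cong opposite (propagate-◅◅ w w′ i)

  propagate-injective : ∀ {u v} (w : Star R u v) {i j} →
                        propagate w i ≡ propagate w j → i ≡ j
  propagate-injective ε       eq = eq
  propagate-injective (_ ◅ w) eq = propagate-injective w (opposite-injective eq)

Unique-shift⁻ : {A : Set} {y : A} → ∀ xs {ys} → Unique (xs ++ y ∷ ys) → Unique (y ∷ xs)
Unique-shift⁻ {A} {y} xs {ys} uniq = AllPairs-++⁻ˡ (y ∷ xs)
  (Permutation.Unique-resp-↭ (setoid A) (↭⇒↭ₛ (shift y xs ys)) uniq)

module _ {V : Set} {G : Graph V} where

  -- The stretch of the path from `a` up to `u` closes up through the edge from `u` to `a`. The
  -- vertex `b` strictly between them guarantees three distinct vertices.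
  chord⇒cycle : ∀ {u a b} xs {ys} → Adj G u a →
                Linked (Adj G) (a ∷ b ∷ xs ++ u ∷ ys) →
                Unique (a ∷ b ∷ xs ++ u ∷ ys) → Cycle G
  chord⇒cycle {u} {a} {b} xs adj linked uniq = record
    { u        = u
    ; vs       = a ∷ b ∷ xs
    ; long     = s≤s (s≤s z≤n)
    ; distinct = Unique-shift⁻ (a ∷ b ∷ xs) uniq
    ; closed   = adj ∷ Linked-∷ʳ⁻ (a ∷ b ∷ xs) linked
    }

  proper-propagate : ∀ {c} → Proper G 2 c → ∀ {u v} (w : Star (Adj G) u v) →
                     c u ≡ propagate w (c v)
  proper-propagate proper ε       = refl
  proper-propagate proper (e ◅ w) =
    trans (≢⇒≡opposite (proper e)) (cong opposite (proper-propagate proper w))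

  opposite-proper : ∀ {c} → Proper G 2 c → Proper G 2 (opposite ∘ c)
  opposite-proper proper e = proper e ∘ opposite-injective

  edge⇒2≤colors : ∀ {u v k c} → Adj G u v → Proper G k c → 2 ≤ k
  edge⇒2≤colors {u} {v} {k} {c} e proper = go k (c u) (c v) (proper e)
    where
    go : ∀ k (i j : Fin k) → i ≢ j → 2 ≤ k
    go (suc zero)    zero zero i≢j = contradiction refl i≢j
    go (suc (suc _)) _    _    _   = s≤s (s≤s z≤n)

module Acyclic {V : Set} (_≟ᵥ_ : DecidableEquality V) (G : Graph V) (acyclic : ¬ Cycle G) where

  open DecMembership _≟ᵥ_ using (_∈?_)

  -- Once the tail is a simple path from `x`, the position of `u` on it decides: absent, the path
  -- extends; first, `e` is a loop; second, `e` is undone; later, a cycle appears.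
  simplify : ∀ {u v} (w : Star (Adj G) u v) →
             ∃[ p ] Simple {R = Adj G} {u} {v} p × propagate p ≗ propagate w
  simplify ε = ε , [] ∷ [] , λ _ → refl
  simplify {u} (_◅_ {j = x} e w) with simplify w
  ... | p , simple , p≗w with u ∈? (x ∷ targets p)
  ... | no u∉ = e ◅ p , ¬Any⇒All¬ _ u∉ ∷ simple , cong opposite ∘ p≗w
  ... | yes (here refl) = contradiction e (Graph.irrefl G)
  -- A backtrack u → x → u: the two flips cancel.
  simplify (e ◅ w) | f ◅ q , _ ∷ simple , p≗w | yes (there (here refl)) =
    q , simple ,
    λ i → trans (sym (opposite-involutive (propagate q i))) (cong opposite (p≗w i))
  simplify (e ◅ w) | f ◅ q , simple , _ | yes (there (there u∈q))
    with xs , ys , eq ← ∈-∃++ u∈q =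
    contradiction
      (chord⇒cycle xs e
        (subst (λ zs → Linked (Adj G) (_ ∷ _ ∷ zs)) eq (targets-linked (f ◅ q)))
        (subst (λ zs → Unique (_ ∷ _ ∷ zs)) eq simple))
      acyclic

  -- A nonempty path back to `v` meets `v` again as its last vertex, so the only simple one is `ε`,
  -- which flips nothing.
  propagate-closed : ∀ {v} (w : Star (Adj G) v v) i → propagate w i ≡ i
  propagate-closed w i with simplify w
  ... | ε     , _      , p≗w = sym (p≗w i)
  ... | _ ◅ q , simple , _   = contradiction (end∈ q) (Unique[x∷xs]⇒x∉xs simple)

module Tree {V : Set} (_≟ᵥ_ : DecidableEquality V) (T : Graph V) (isTree : IsTree T) where

  open IsTree isTree
  open Acyclic _≟ᵥ_ T acyclic

  -- The walk to the root is whichever one connectedness supplies; no simple path has to be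
  -- selected, because closed walks have no effect on colours.
  coloring : V → Fin 2 → V → Fin 2
  coloring r i v = propagate (connected v r) i

  coloring-root : ∀ r i → coloring r i r ≡ i
  coloring-root r = propagate-closed (connected r r)

  coloring-proper : ∀ r i → Proper T 2 (coloring r i)
  coloring-proper r i {u} {v} e cu≡cv =
    -- Two closed walks at `r` both go out to `u` along `back`; one returns directly, the other
    -- through `v`. Both fix `i`, so cancelling `back` makes the colour of `u` the flip of that of
    -- `v`.
    opposite-≢ (coloring r i v) (trans (sym cu≡cv) (propagate-injective back (begin
      propagate back (propagate (connected u r) i)  ≡⟨ propagate-◅◅ back (connected u r) i ⟨
      propagate (back ◅◅ connected u r) i           ≡⟨ propagate-closed (back ◅◅ connected u r) i ⟩
      i                                             ≡⟨ propagate-closed (back ◅◅ forth) i ⟨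
      propagate (back ◅◅ forth) i                   ≡⟨ propagate-◅◅ back forth i ⟩
      propagate back (propagate forth i)            ∎)))
    where
    open ≡-Reasoning
    back  = connected r u
    forth = e ◅ connected v r

  coloring-unique : ∀ r {c} → Proper T 2 c → coloring r (c r) ≗ c
  coloring-unique r proper v = sym (proper-propagate {G = T} proper (connected v r))

module _ {n} {G : Graph (Fin n)} where

  sudoku⇒nonempty : Fin n → ∀ {S c₀} → IsSudokuColoring G 2 S c₀ → 1 ≤ ∣ S ∣
  sudoku⇒nonempty r {S} {c₀} (_ , c , (proper , extends) , unique) with ∣ S ∣ in size
  ... | suc _ = s≤s z≤n
  -- With no clues the flipped colouring extends `c₀` vacuously, so uniqueness would equate the two
  -- colours at `r`.
  ... | zero  = contradiction
    (unique (opposite-proper {G = G} proper , λ (v , v∈S) → contradiction v∈S (empty v)) r)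
    (opposite-≢ (c r))
    where
    empty : ∀ v → ¬ v ∈ S
    empty v v∈S
      -- A member `v` would give an inclusion of the singleton of `v` in `S`, hence `1 ≤ 0`.
      with () ← subst (1 ≤_) size (subst (_≤ ∣ S ∣) (∣⁅x⁆∣≡1 v)
        (p⊆q⇒∣p∣≤∣q∣ λ x∈ → subst (_∈ S) (sym (x∈⁅y⁆⇒x≡y v x∈)) v∈S))

corollary3p2 : ∀ (n : ℕ) (T : Graph (Fin n)) → 2 ≤ n → IsTree T → IsSudokuNumber T 1
corollary3p2 (suc (suc n)) T (s≤s (s≤s _)) isTree = record
  { connected = connected
  ; k         = 2
  ; chromatic = (coloring r i , coloring-proper r i) , λ _ (_ , proper) → 2≤colors proper
  ; 2≤k       = s≤s (s≤s z≤n)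
  ; least     = (⁅ r ⁆ , ∣⁅x⁆∣≡1 r , (λ _ → i) , (λ {u} {v} → induced-proper {u} {v})
                , coloring r i , (coloring-proper r i , agrees) , unique)
              , λ { _ (_ , refl , _ , sudoku) → sudoku⇒nonempty {G = T} r sudoku }
  }
  where
  open IsTree isTree
  open Tree _≟_ T isTree

  r : Fin (suc (suc n))
  r = zero

  i : Fin 2
  i = zero

  2≤colors : ∀ {k c} → Proper T k c → 2 ≤ k
  -- The endpoints differ, so the walk cannot be empty and its first step is an edge.
  2≤colors proper with connected zero (suc zero)
  ... | e ◅ _ = edge⇒2≤colors {G = T} e proper

  induced-proper : Proper (induced T ⁅ r ⁆) 2 (λ _ → i)
  induced-proper {u , u∈} {v , v∈} e _
    with refl ← x∈⁅y⁆⇒x≡y r u∈ | refl ← x∈⁅y⁆⇒x≡y r v∈ = Graph.irrefl T e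

  agrees : coloring r i ∘ proj₁ ≗ (λ (_ : ∃ (_∈ ⁅ r ⁆)) → i)
  agrees (v , v∈) with refl ← x∈⁅y⁆⇒x≡y r v∈ = coloring-root r i

  unique : ∀ {c} → Proper T 2 c × (c ∘ proj₁ ≗ (λ (_ : ∃ (_∈ ⁅ r ⁆)) → i)) →
           coloring r i ≗ c
  unique {c} (proper , extends) =
    -- The clue says that `c r` is `i`, which turns the colouring seeded by `c r` into the one
    -- seeded by `i`.
    subst (λ j → coloring r j ≗ c) (extends (r , x∈⁅x⁆ r)) (coloring-unique r proper)
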